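{- Let $G(L)=(V,E,L)$ be a temporal graph or temporal digraph and $s\in V$. The time complexity of the Foremost Journey Algorithm (described in the context) on input $(G(L),s)$ is $O\big(c(L)\cdot\log c(L)\big)$, where $c(L)=\sum_{e\in E}|L_e|$.
   Context: A temporal (di)graph is a triple $G(L)=(V,E,L)$ where $(V,E)$ is a finite (di)graph and $L=\{L_e\subseteq\mathbb{N}^*: e\in E\}$ assigns to each edge (arc) a (finite) set of positive integer labels. The cost of $L$ is $c(L)=\sum_{e\in E}|L_e|$. A time edge is a triple $(u,v,l)$ where $e=\{u,v\}$ (resp. $e=(u,v)$) is an edge (resp. arc) and $l\in L_e$; an undirected edge $\{u,v\}$ yields both $(u,v,l)$ and $(v,u,l)$ for every $l\in L_e$. $S(L)$ denotes the set of all time edges (arcs). Foremost Journey Algorithm (input: $G(L)$, $s$): 1. Sort $S(L)$ in increasing order of labels (by a comparison-based sort); let $S'$ be the sorted array. 2. Set $R:=\{s\}$, $arrival\_time[s]:=0$, and for all $v\in V\setminus\{s\}$ set $parent[v]:=\emptyset$, $arrival\_time[v]:=+\infty$. 3. For all time edges (arcs) $(a,b,l)$ in the order given by $S'$: if $a\in R$ and $b\notin R$ and $arrival\_time[a]<l$, then set $parent[b]:=a$, $arrival\_time[b]:=l$, $R:=R\cup\{b\}$.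
   Formalization: Assigning to every vertex in step 2 costs order |V|, unbounded in c(L) with isolated vertices; so step 2 is implemented by constant-time array initialisation (every access charged). S(L) is given as an unsorted array, its construction is not charged; the sort is merge sort. -}

module Defs where

open import Data.Bool.Base using (Bool; true; false; if_then_else_; _∧_; not)
open import Data.Fin.Base using (Fin) renaming (_<_ to _<ᶠ_)
import Data.Fin.Properties as Fin
open import Data.List.Base using (List; []; _∷_; [_]; length; map; concatMap; allFin; foldl; merge)
open import Data.List.Relation.Unary.All using (All)
open import Data.List.Relation.Unary.Unique.Propositional using (Unique)
import Data.List.Sort.MergeSort
open import Data.Maybe.Base using (Maybe; just; nothing)
open import Data.Nat.Base using (ℕ; suc; _+_; _<_; z<s; s<s)
open import Data.Nat.Induction using (Acc; acc; <-wellFounded-fast)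
open import Data.Nat.ListAction using (sum)
import Data.Nat.Properties as ℕ
open import Data.Product.Base using (_×_; _,_; proj₁; proj₂)
open import Function.Base using (_∘_)
open import Function.Definitions using (Injective)
open import Level using (0ℓ)
open import Relation.Binary.Bundles using (DecTotalOrder)
import Relation.Binary.Construct.Add.Supremum.Strict as Supremum
import Relation.Binary.Construct.On as On
open import Relation.Binary.Definitions using (DecidableEquality; Decidable)
open import Relation.Binary.PropositionalEquality
  using (_≡_; refl; sym; trans; cong; cong₂)
open import Relation.Nullary.Construct.Add.Supremum using (_⁺; ⊤⁺) renaming ([_] to fin)
open import Relation.Nullary.Decidable using (does; yes; no; dec-true; dec-false)

private variable
  A B I : Set
  n : ℕ

data Kind : Set where
  undirected directed : Kind

record LabelSet : Set where
  field
    elements : List ℕ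
    unique   : Unique elements
    positive : All (0 <_) elements

open LabelSet public

record TemporalGraph (κ : Kind) : Set where
  field
    order size     : ℕ
    ends           : Fin size → Fin order × Fin order
    ends-injective : Injective _≡_ _≡_ ends
    -- An undirected edge {u , v} is stored once, with its smaller endpoint
    -- first; this also excludes undirected loops.
    ends-ordered   : κ ≡ undirected → ∀ e → proj₁ (ends e) <ᶠ proj₂ (ends e)
    labels         : Fin size → LabelSet

  Vertex : Set
  Vertex = Fin order

open TemporalGraph public

cost : ∀ {κ} → TemporalGraph κ → ℕ
cost G = sum (map (length ∘ elements ∘ labels G) (allFin (size G)))

record TimeEdge (n : ℕ) : Set where
  constructor timeEdge
  field
    tail head : Fin n
    label     : ℕ

open TimeEdge public

timeEdgesOf : Kind → Fin n × Fin n → ℕ → List (TimeEdge n)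
timeEdgesOf undirected (u , v) l = timeEdge u v l ∷ timeEdge v u l ∷ []
timeEdgesOf directed   (u , v) l = timeEdge u v l ∷ []

timeEdges : ∀ {κ} (G : TemporalGraph κ) → List (TimeEdge (order G))
timeEdges {κ} G =
  concatMap (λ e → concatMap (timeEdgesOf κ (ends G e)) (elements (labels G e)))
            (allFin (size G))

-- Time edges compared by label; the underlying equality is "same label".
byLabel : ℕ → DecTotalOrder 0ℓ 0ℓ 0ℓ
byLabel n = On.decTotalOrder ℕ.≤-decTotalOrder (label {n})

update : DecidableEquality I → (I → A) → I → A → (I → A)
update _≟_ f i x j = if does (i ≟ j) then x else f j

_<⁺?_ : Decidable (Supremum._<⁺_ _<_)
_<⁺?_ = Supremum.<⁺-dec _<_ ℕ._<?_

-- ⊤⁺ plays the role of +∞ and nothing that of ∅.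
record Journeys (n : ℕ) : Set where
  field
    reached : Fin n → Bool
    parent  : Fin n → Maybe (Fin n)
    arrival : Fin n → ℕ ⁺

initialSpec : Fin n → Journeys n
initialSpec s = record
  { reached = update Fin._≟_ (λ _ → false) s true
  ; parent  = λ _ → nothing
  ; arrival = update Fin._≟_ (λ _ → ⊤⁺) s (fin 0)
  }

relaxSpec : Journeys n → TimeEdge n → Journeys n
relaxSpec J (timeEdge a b l) =
  if reached a ∧ not (reached b) ∧ does (arrival a <⁺? fin l)
  then record
    { reached = update Fin._≟_ reached b true
    ; parent  = update Fin._≟_ parent b (just a)
    ; arrival = update Fin._≟_ arrival b (fin l)
    }
  else J
  where open Journeys J

foremostJourneySpec : List (TimeEdge n) → Fin n → Journeys n
foremostJourneySpec {n} S s =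
  foldl relaxSpec (initialSpec s) (Data.List.Sort.MergeSort.sort (byLabel n) S)

-- One unit is charged for every memory access, every comparison and every
-- value returned by a function clause. A clause performs only boundedly many
-- constant-time operations besides these, so the count is the running time
-- on a unit-cost RAM up to a constant factor.

infix 4 _after_

record Timed (A : Set) : Set where
  constructor _after_
  field
    value : A
    time  : ℕ

open Timed public

infixl 1 _>>=_ _>>_

_>>=_ : Timed A → (A → Timed B) → Timed B
m >>= f = value (f (value m)) after time m + time (f (value m))

_>>_ : Timed A → Timed B → Timed B
m >> k = m >>= λ _ → k

step : A → Timed A
step x = x after 1

-- An n-entry array is created in O(1) on top of memory with arbitrary
-- initial contents (Aho, Hopcroft & Ullman 1974, Exercise 2.12). Entry i has
-- been written iff back i < top and stack (back i) ≡ i; all other entries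
-- read as the default. Without this, the assignments to all v ∈ V would
-- cost Θ(|V|), which isolated vertices make unbounded in terms of c(L).

record Block (n : ℕ) (A : Set) : Set where
  field
    cells : Fin n → A
    back  : Fin n → ℕ
    stack : ℕ → Fin n

record Array (n : ℕ) (A : Set) : Set where
  field
    default : A
    top     : ℕ
    block   : Block n A
  open Block block public

load : (I → A) → I → Timed A
load m i = step (m i)

store : DecidableEquality I → (I → A) → I → A → Timed (I → A)
store _≟_ m i x = step (update _≟_ m i x)

newArray : Block n A → A → Timed (Array n A)
newArray m x = step (record { default = x ; top = 0 ; block = m })

written? : Array n A → Fin n → Timed Bool
written? a i = do
  k ← load back i
  b ← step (does (k ℕ.<? top))
  if b
    then (do j ← load stack k
             step (does (j Fin.≟ i)))
    else step false
  where open Array a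

readArray : Array n A → Fin n → Timed A
readArray a i = do
  w ← written? a i
  if w then load cells i else step default
  where open Array a

writeArray : Array n A → Fin n → A → Timed (Array n A)
writeArray a i x = do
  w      ← written? a i
  cells′ ← store Fin._≟_ cells i x
  if w
    then step (record a { block = record block { cells = cells′ } })
    else (do
      back′  ← store Fin._≟_ back i top
      stack′ ← store ℕ._≟_ stack top i
      step (record
        { default = default
        ; top     = suc top
        ; block   = record { cells = cells′ ; back = back′ ; stack = stack′ }
        }))
  where open Array a

module TimedMergeSort (O : DecTotalOrder 0ℓ 0ℓ 0ℓ) where

  open DecTotalOrder O using (_≤?_) renaming (Carrier to X)

  mergeᵗ : List X → List X → Timed (List X)
  mergeᵗ []       ys       = step ys
  mergeᵗ (x ∷ xs) []       = step (x ∷ xs)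
  mergeᵗ (x ∷ xs) (y ∷ ys) = do
    b ← step (does (x ≤? y))
    if b
      then (do zs ← mergeᵗ xs (y ∷ ys)
               step (x ∷ zs))
      else (do zs ← mergeᵗ (x ∷ xs) ys
               step (y ∷ zs))

  mergePairsᵗ : List (List X) → Timed (List (List X))
  mergePairsᵗ (xs ∷ ys ∷ xss) = do
    zs  ← mergeᵗ xs ys
    zss ← mergePairsᵗ xss
    step (zs ∷ zss)
  mergePairsᵗ xss = step xss

  mergePairsᵗ-shrinks : ∀ xs ys xss → let yss = xs ∷ ys ∷ xss in
                        length (value (mergePairsᵗ yss)) < length yss
  mergePairsᵗ-shrinks _ _ []              = s<s z<s
  mergePairsᵗ-shrinks _ _ (_ ∷ [])        = s<s (s<s z<s)
  mergePairsᵗ-shrinks _ _ (xs ∷ ys ∷ xss) =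
    s<s (ℕ.m<n⇒m<1+n (mergePairsᵗ-shrinks xs ys xss))

  mergeAllᵗ : (xss : List (List X)) → Acc _<_ (length xss) → Timed (List X)
  mergeAllᵗ []              _         = step []
  mergeAllᵗ (xs ∷ [])       _         = step xs
  mergeAllᵗ (xs ∷ ys ∷ xss) (acc rec) = do
    round
    mergeAllᵗ (value round) (rec (mergePairsᵗ-shrinks xs ys xss))
    where round = mergePairsᵗ (xs ∷ ys ∷ xss)

  singletonsᵗ : List X → Timed (List (List X))
  singletonsᵗ []       = step []
  singletonsᵗ (x ∷ xs) = do
    xss ← singletonsᵗ xs
    step ([ x ] ∷ xss)

  sortᵗ : List X → Timed (List X)
  sortᵗ xs = do
    xss ← singletonsᵗ xs
    mergeAllᵗ xss (<-wellFounded-fast _)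

record Memory (n : ℕ) : Set where
  field
    reachedBlock : Block n Bool
    parentBlock  : Block n (Maybe (Fin n))
    arrivalBlock : Block n (ℕ ⁺)

record State (n : ℕ) : Set where
  constructor state
  field
    reached : Array n Bool
    parent  : Array n (Maybe (Fin n))
    arrival : Array n (ℕ ⁺)

initialise : Memory n → Fin n → Timed (State n)
initialise mem s = do
  r₀ ← newArray reachedBlock false
  r  ← writeArray r₀ s true
  p  ← newArray parentBlock nothing
  t₀ ← newArray arrivalBlock ⊤⁺
  t  ← writeArray t₀ s (fin 0)
  step (state r p t)
  where open Memory mem

relax : State n → TimeEdge n → Timed (State n)
relax st (timeEdge a b l) = do
  ra ← readArray reached a
  rb ← readArray reached b
  ta ← readArray arrival a
  lt ← step (does (ta <⁺? fin l))
  if ra ∧ not rb ∧ lt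
    then (do
      p ← writeArray parent b (just a)
      t ← writeArray arrival b (fin l)
      r ← writeArray reached b true
      step (state r p t))
    else step st
  where open State st

relaxAll : State n → List (TimeEdge n) → Timed (State n)
relaxAll st []       = step st
relaxAll st (e ∷ es) = do
  st′ ← relax st e
  relaxAll st′ es

-- S is an array holding S(L), mem the initial contents of the work memory.
foremostJourney : Memory n → List (TimeEdge n) → Fin n → Timed (State n)
foremostJourney {n} mem S s = do
  S′ ← TimedMergeSort.sortᵗ (byLabel n) S
  st ← initialise mem s
  relaxAll st S′

entry : Array n A → Fin n → A
entry a i = value (readArray a i)

entry-new : ∀ (m : Block n A) x i → entry (value (newArray m x)) i ≡ x
entry-new m x i = refl

entry-write : ∀ (a : Array n A) i x j →
              entry (value (writeArray a i x)) j ≡ update Fin._≟_ (entry a) i x j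
entry-write a i x j with value (written? a i) in eq | i Fin.≟ j
... | true | yes refl rewrite eq | dec-true (i Fin.≟ i) refl = refl
... | true | no i≢j rewrite dec-false (i Fin.≟ j) i≢j = refl
... | false | yes refl
  rewrite dec-true (i Fin.≟ i) refl
        | dec-true (Array.top a ℕ.<? suc (Array.top a)) ℕ.≤-refl
        | dec-true (Array.top a ℕ.≟ Array.top a) refl
        | dec-true (i Fin.≟ i) refl
        = refl
... | false | no i≢j
  rewrite dec-false (i Fin.≟ j) i≢j
  with Array.back a j ℕ.<? Array.top a
... | yes k<t
  rewrite dec-true (Array.back a j ℕ.<? suc (Array.top a)) (ℕ.m<n⇒m<1+n k<t)
        | dec-true (Array.back a j ℕ.<? Array.top a) k<t
        | dec-false (Array.top a ℕ.≟ Array.back a j) (ℕ.>⇒≢ k<t)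
        = refl
... | no k≮t with Array.top a ℕ.≟ Array.back a j
...   | yes refl
  rewrite dec-true (Array.top a ℕ.<? suc (Array.top a)) ℕ.≤-refl
        | dec-false (Array.top a ℕ.<? Array.top a) k≮t
        | dec-true (Array.top a ℕ.≟ Array.top a) refl
        | dec-false (i Fin.≟ j) i≢j
        = refl
...   | no t≢k
  rewrite dec-false (Array.back a j ℕ.<? suc (Array.top a))
            (λ k<1+t → k≮t (ℕ.≤∧≢⇒< (ℕ.≤-pred k<1+t) (t≢k ∘ sym)))
        | dec-false (Array.back a j ℕ.<? Array.top a) k≮t
        = refl

module _ (O : DecTotalOrder 0ℓ 0ℓ 0ℓ) where
  open TimedMergeSort O
  open DecTotalOrder O using (_≤?_)
  open Data.List.Sort.MergeSort O using (mergePairs; mergeAll; sort)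

  mergeᵗ-value : ∀ xs ys → value (mergeᵗ xs ys) ≡ merge _≤?_ xs ys
  mergeᵗ-value []       ys       = refl
  mergeᵗ-value (x ∷ xs) []       = refl
  mergeᵗ-value (x ∷ xs) (y ∷ ys)
    with does (x ≤? y) | mergeᵗ-value xs (y ∷ ys) | mergeᵗ-value (x ∷ xs) ys
  ... | true  | eq | _  = cong (x ∷_) eq
  ... | false | _  | eq = cong (y ∷_) eq

  mergePairsᵗ-value : ∀ xss → value (mergePairsᵗ xss) ≡ mergePairs xss
  mergePairsᵗ-value []              = refl
  mergePairsᵗ-value (xs ∷ [])       = refl
  mergePairsᵗ-value (xs ∷ ys ∷ xss) =
    cong₂ _∷_ (mergeᵗ-value xs ys) (mergePairsᵗ-value xss)

  mergeAllᵗ-value : ∀ {xss yss} p q → xss ≡ yss →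
                    value (mergeAllᵗ xss p) ≡ mergeAll yss q
  mergeAllᵗ-value {[]}            p       q       refl = refl
  mergeAllᵗ-value {_ ∷ []}        p       q       refl = refl
  mergeAllᵗ-value {xs ∷ ys ∷ xss} (acc _) (acc _) refl =
    mergeAllᵗ-value _ _ (mergePairsᵗ-value (xs ∷ ys ∷ xss))

  singletonsᵗ-value : ∀ xs → value (singletonsᵗ xs) ≡ map [_] xs
  singletonsᵗ-value []       = refl
  singletonsᵗ-value (x ∷ xs) = cong ([ x ] ∷_) (singletonsᵗ-value xs)

  sortᵗ-value : ∀ xs → value (sortᵗ xs) ≡ sort xs
  sortᵗ-value xs = mergeAllᵗ-value _ _ (singletonsᵗ-value xs)

infix 4 _≗ᴶ_

record _≗ᴶ_ (st : State n) (J : Journeys n) : Set where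
  field
    reached≗ : ∀ v → entry (State.reached st) v ≡ Journeys.reached J v
    parent≗  : ∀ v → entry (State.parent  st) v ≡ Journeys.parent  J v
    arrival≗ : ∀ v → entry (State.arrival st) v ≡ Journeys.arrival J v

open _≗ᴶ_

entry-write-≗ : ∀ (a : Array n A) {f : Fin n → A} → (∀ v → entry a v ≡ f v) → ∀ i x v →
                entry (value (writeArray a i x)) v ≡ update Fin._≟_ f i x v
entry-write-≗ a a≗f i x v =
  trans (entry-write a i x v) (cong (if does (i Fin.≟ v) then x else_) (a≗f v))

initialise-correct : ∀ (mem : Memory n) s → value (initialise mem s) ≗ᴶ initialSpec s
initialise-correct mem s = record
  { reached≗ = entry-write-≗ (value (newArray reachedBlock false)) (λ _ → refl) s true
  ; parent≗  = λ _ → refl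
  ; arrival≗ = entry-write-≗ (value (newArray arrivalBlock ⊤⁺)) (λ _ → refl) s (fin 0)
  }
  where open Memory mem

relax-correct : ∀ (st : State n) {J} e → st ≗ᴶ J → value (relax st e) ≗ᴶ relaxSpec J e
relax-correct st {J} (timeEdge a b l) st≗J
  rewrite reached≗ st≗J a | reached≗ st≗J b | arrival≗ st≗J a
  with Journeys.reached J a ∧ not (Journeys.reached J b)
         ∧ does (Journeys.arrival J a <⁺? fin l)
... | false = st≗J
... | true  = record
  { reached≗ = entry-write-≗ (State.reached st) (reached≗ st≗J) b true
  ; parent≗  = entry-write-≗ (State.parent  st) (parent≗  st≗J) b (just a)
  ; arrival≗ = entry-write-≗ (State.arrival st) (arrival≗ st≗J) b (fin l)
  }

relaxAll-correct : ∀ (st : State n) {J} es → st ≗ᴶ J →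
                   value (relaxAll st es) ≗ᴶ foldl relaxSpec J es
relaxAll-correct st []       st≗J = st≗J
relaxAll-correct st (e ∷ es) st≗J = relaxAll-correct _ es (relax-correct st e st≗J)

foremostJourney-correct : ∀ (mem : Memory n) S s →
  value (foremostJourney mem S s) ≗ᴶ foremostJourneySpec S s
foremostJourney-correct {n} mem S s
  rewrite sym (sortᵗ-value (byLabel n) S)
  = relaxAll-correct _ (value (TimedMergeSort.sortᵗ (byLabel n) S)) (initialise-correct mem s)

{-# OPTIONS --safe #-}

-- Merge sort on m time edges makes at most k rounds when m ≤ 2 ^ k, and each
-- round costs O(m); every relaxation costs O(1), as does the initialisation
-- thanks to the lazily initialised arrays. Each label yields at most two time
-- edges, so m ≤ 2 c(L) ≤ 2 ^ (2 + ⌊log₂ c(L)⌋), and for c(L) ≥ 2 the lower-order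
-- terms are absorbed by c(L) · ⌊log₂ c(L)⌋.
module Submission where

open import Defs
open import Data.Bool.Base using (true; false; if_then_else_; _∧_; not)
open import Data.Fin.Base using (Fin)
open import Data.List.Base using (List; []; _∷_; length; map; concat; concatMap; allFin)
open import Data.List.Properties using (length-++)
open import Data.List.Relation.Binary.Permutation.Propositional using (_↭_)
open import Data.List.Relation.Binary.Permutation.Propositional.Properties using (↭-length)
open import Data.List.Sort.MergeSort.Properties using (mergePairs-↭; sort-↭)
open import Data.Maybe.Base using (just)
open import Data.Nat.Base
  using (ℕ; zero; suc; _+_; _*_; _^_; _≤_; _<_; z≤n; s≤s; ⌈_/2⌉; NonZero; >-nonZero)
open import Data.Nat.Induction using (Acc; acc)
open import Data.Nat.ListAction using (sum)
open import Data.Nat.Logarithm using (⌊log₂_⌋; ⌊log₂⌋-mono-≤; ⌊log₂[2^n]⌋≡n)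
open import Data.Nat.Properties hiding (_≤?_)
open import Data.Nat.Tactic.RingSolver using (solve-∀)
open import Data.Product.Base using (∃-syntax; _×_; _,_)
open import Function.Base using (_∘_)
open import Level using (0ℓ)
open import Relation.Binary.Bundles using (DecTotalOrder)
open import Relation.Binary.PropositionalEquality
  using (_≡_; refl; sym; trans; cong; subst)
open import Relation.Nullary.Construct.Add.Supremum using (⊤⁺) renaming ([_] to fin)
open import Relation.Nullary.Decidable using (does)

private variable
  A B : Set
  n : ℕ

open ≤-Reasoning

-- Powers of two and the number of time edges

n<2^[1+⌊log₂n⌋] : ∀ n → n < 2 ^ suc ⌊log₂ n ⌋
n<2^[1+⌊log₂n⌋] n = ≰⇒> λ 2^[1+l]≤n →
  -- Taking logarithms of `2 ^ suc l ≤ n`, with `l = ⌊log₂ n ⌋`, would give `suc l ≤ l`.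
  <-irrefl refl (subst (_≤ ⌊log₂ n ⌋) (⌊log₂[2^n]⌋≡n _) (⌊log₂⌋-mono-≤ 2^[1+l]≤n))

-- Each merge round halves the number of lists, rounding up, so it uses up one unit of the exponent.
⌈n/2⌉≤2^k : ∀ k {n} → n ≤ 2 ^ suc k → ⌈ n /2⌉ ≤ 2 ^ k
⌈n/2⌉≤2^k k {n} n≤2^[1+k] = begin
  ⌈ n /2⌉                ≤⟨ ⌈n/2⌉-mono n≤2^[1+k] ⟩
  ⌈ 2 * 2 ^ k /2⌉        ≡⟨ cong (λ x → ⌈ 2 ^ k + x /2⌉) (+-identityʳ (2 ^ k)) ⟩
  ⌈ 2 ^ k + 2 ^ k /2⌉    ≡⟨ n≡⌈n+n/2⌉ (2 ^ k) ⟨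
  2 ^ k                  ∎

-- Used at both levels of the nested `concatMap` in `timeEdges`: over the labels of one edge with
-- weight 1 each, and over the edges weighted by their numbers of labels, whose sum is `cost G`.
length-concatMap-≤ : ∀ k {f : A → List B} (g : A → ℕ) → (∀ x → length (f x) ≤ k * g x) →
                     ∀ xs → length (concatMap f xs) ≤ k * sum (map g xs)
length-concatMap-≤ k         g f≤g []       = z≤n
length-concatMap-≤ k {f = f} g f≤g (x ∷ xs) = begin
  length (concatMap f (x ∷ xs))          ≡⟨ length-++ (f x) ⟩
  length (f x) + length (concatMap f xs) ≤⟨ +-mono-≤ (f≤g x) (length-concatMap-≤ k g f≤g xs) ⟩
  k * g x + k * sum (map g xs)           ≡⟨ *-distribˡ-+ k (g x) _ ⟨
  k * (g x + sum (map g xs))             ∎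

sum-map-1 : ∀ (xs : List A) → sum (map (λ _ → 1) xs) ≡ length xs
sum-map-1 []       = refl
sum-map-1 (x ∷ xs) = cong suc (sum-map-1 xs)

length-timeEdgesOf : ∀ κ (uv : Fin n × Fin n) l → length (timeEdgesOf κ uv l) ≤ 2
length-timeEdgesOf undirected uv l = ≤-refl
length-timeEdgesOf directed   uv l = s≤s z≤n

length-timeEdges : ∀ {κ} (G : TemporalGraph κ) → length (timeEdges G) ≤ 2 * cost G
length-timeEdges {κ} G = length-concatMap-≤ 2 (length ∘ elements ∘ labels G) edge≤ (allFin (size G))
  where
  edge≤ : ∀ e → length (concatMap (timeEdgesOf κ (ends G e)) (elements (labels G e)))
                  ≤ 2 * length (elements (labels G e))
  edge≤ e = begin
    length (concatMap (timeEdgesOf κ (ends G e)) ls)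
      ≤⟨ length-concatMap-≤ 2 (λ _ → 1) (length-timeEdgesOf κ (ends G e)) ls ⟩
    2 * sum (map (λ _ → 1) ls)
      ≡⟨ cong (2 *_) (sum-map-1 ls) ⟩
    2 * length ls
      ∎
    where ls = elements (labels G e)

-- Running time of merge sort

module _ (O : DecTotalOrder 0ℓ 0ℓ 0ℓ) where
  open TimedMergeSort O
  open DecTotalOrder O using (_≤?_)

  -- Each element output before one list runs out costs 2, one for the comparison and one for the
  -- returned cons; the remaining list is returned whole at cost 1.
  time-mergeᵗ : ∀ xs ys → time (mergeᵗ xs ys) ≤ 1 + 2 * (length xs + length ys)
  time-mergeᵗ []       ys       = s≤s z≤n
  time-mergeᵗ (x ∷ xs) []       = s≤s z≤n
  time-mergeᵗ (x ∷ xs) (y ∷ ys)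
    with does (x ≤? y) | time-mergeᵗ xs (y ∷ ys) | time-mergeᵗ (x ∷ xs) ys
  ... | true  | rec≤ | _ = begin
    1 + (time (mergeᵗ xs (y ∷ ys)) + 1)             ≤⟨ +-monoʳ-≤ 1 (+-monoˡ-≤ 1 rec≤) ⟩
    1 + (1 + 2 * (length xs + suc (length ys)) + 1) ≡⟨ eq (length xs) (length ys) ⟩
    1 + 2 * (suc (length xs) + suc (length ys))     ∎
    where
    eq : ∀ a b → 1 + (1 + 2 * (a + suc b) + 1) ≡ 1 + 2 * (suc a + suc b)
    eq = solve-∀
  ... | false | _ | rec≤ = begin
    1 + (time (mergeᵗ (x ∷ xs) ys) + 1)             ≤⟨ +-monoʳ-≤ 1 (+-monoˡ-≤ 1 rec≤) ⟩
    1 + (1 + 2 * (suc (length xs) + length ys) + 1) ≡⟨ eq (length xs) (length ys) ⟩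
    1 + 2 * (suc (length xs) + suc (length ys))     ∎
    where
    eq : ∀ a b → 1 + (1 + 2 * (suc a + b) + 1) ≡ 1 + 2 * (suc a + suc b)
    eq = solve-∀

  -- Besides 2 per element, a pair costs 1 to finish its merge and 1 for the cons. These are charged
  -- to its two lists, whence the summand `length xss`.
  time-mergePairsᵗ : ∀ xss → time (mergePairsᵗ xss) ≤ 1 + 2 * length (concat xss) + length xss
  time-mergePairsᵗ []              = s≤s z≤n
  time-mergePairsᵗ (xs ∷ [])       = s≤s z≤n
  time-mergePairsᵗ (xs ∷ ys ∷ xss) = begin
    time (mergeᵗ xs ys) + (time (mergePairsᵗ xss) + 1)
      ≤⟨ +-mono-≤ (time-mergeᵗ xs ys) (+-monoˡ-≤ 1 (time-mergePairsᵗ xss)) ⟩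
    1 + 2 * (length xs + length ys) + (1 + 2 * length (concat xss) + length xss + 1)
      ≡⟨ eq (length xs) (length ys) (length (concat xss)) (length xss) ⟩
    1 + 2 * (length xs + (length ys + length (concat xss))) + suc (suc (length xss))
      ≡⟨ cong (λ t → 1 + 2 * t + suc (suc (length xss)))
           (trans (length-++ xs) (cong (length xs +_) (length-++ ys))) ⟨
    1 + 2 * length (concat (xs ∷ ys ∷ xss)) + suc (suc (length xss))
      ∎
    where
    eq : ∀ a b t p → 1 + 2 * (a + b) + (1 + 2 * t + p + 1) ≡ 1 + 2 * (a + (b + t)) + suc (suc p)
    eq = solve-∀

  length-mergePairsᵗ : ∀ xss → length (value (mergePairsᵗ xss)) ≡ ⌈ length xss /2⌉
  length-mergePairsᵗ []              = refl
  length-mergePairsᵗ (xs ∷ [])       = refl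
  length-mergePairsᵗ (xs ∷ ys ∷ xss) = cong suc (length-mergePairsᵗ xss)

  length-concat-mergePairsᵗ : ∀ xss →
    length (concat (value (mergePairsᵗ xss))) ≡ length (concat xss)
  length-concat-mergePairsᵗ xss =
    trans (cong (length ∘ concat) (mergePairsᵗ-value O xss)) (↭-length (mergePairs-↭ O xss))

  -- Induction on the number `k` of rounds. The bound `m` covers both the number of lists, which
  -- shrinks, and the number of elements, which merging preserves; lists may be empty here, so
  -- neither bound implies the other. A round thus costs at most `1 + 3 * m`.
  time-mergeAllᵗ : ∀ k {m} xss (wf : Acc _<_ (length xss)) →
                   length xss ≤ 2 ^ k → length xss ≤ m → length (concat xss) ≤ m →
                   time (mergeAllᵗ xss wf) ≤ 1 + k * (1 + 3 * m)
  time-mergeAllᵗ k       []        wf _ _ _ = s≤s z≤n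
  time-mergeAllᵗ k       (xs ∷ []) wf _ _ _ = s≤s z≤n
  time-mergeAllᵗ zero    (xs ∷ ys ∷ xss) wf (s≤s ()) _ _
  time-mergeAllᵗ (suc k) {m} xss@(xs ∷ ys ∷ zss) (acc rec) p≤2^[1+k] p≤m t≤m = begin
    time (mergePairsᵗ xss) + time (mergeAllᵗ xss′ (rec _))
      ≤⟨ +-mono-≤ round≤ (time-mergeAllᵗ k xss′ (rec _) p′≤2^k p′≤m t′≤m) ⟩
    1 + 2 * m + m + (1 + k * (1 + 3 * m))
      ≡⟨ eq k m ⟩
    1 + suc k * (1 + 3 * m)
      ∎
    where
    xss′ = value (mergePairsᵗ xss)

    round≤ : time (mergePairsᵗ xss) ≤ 1 + 2 * m + m
    round≤ = ≤-trans (time-mergePairsᵗ xss) (+-mono-≤ (+-monoʳ-≤ 1 (*-monoʳ-≤ 2 t≤m)) p≤m)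

    p′≤2^k : length xss′ ≤ 2 ^ k
    p′≤2^k = subst (_≤ 2 ^ k) (sym (length-mergePairsᵗ xss)) (⌈n/2⌉≤2^k k p≤2^[1+k])

    p′≤m : length xss′ ≤ m
    p′≤m = ≤-trans (<⇒≤ (mergePairsᵗ-shrinks xs ys zss)) p≤m

    t′≤m : length (concat xss′) ≤ m
    t′≤m = subst (_≤ m) (sym (length-concat-mergePairsᵗ xss)) t≤m

    eq : ∀ k m → 1 + 2 * m + m + (1 + k * (1 + 3 * m)) ≡ 1 + suc k * (1 + 3 * m)
    eq = solve-∀

  time-singletonsᵗ : ∀ xs → time (singletonsᵗ xs) ≡ length xs + 1
  time-singletonsᵗ []       = refl
  time-singletonsᵗ (x ∷ xs) = trans (+-comm _ 1) (cong suc (time-singletonsᵗ xs))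

  length-singletonsᵗ : ∀ xs → length (value (singletonsᵗ xs)) ≡ length xs
  length-singletonsᵗ []       = refl
  length-singletonsᵗ (x ∷ xs) = cong suc (length-singletonsᵗ xs)

  length-concat-singletonsᵗ : ∀ xs → length (concat (value (singletonsᵗ xs))) ≡ length xs
  length-concat-singletonsᵗ []       = refl
  length-concat-singletonsᵗ (x ∷ xs) = cong suc (length-concat-singletonsᵗ xs)

  time-sortᵗ : ∀ k xs → length xs ≤ 2 ^ k →
               time (sortᵗ xs) ≤ length xs + 1 + (1 + k * (1 + 3 * length xs))
  time-sortᵗ k xs m≤2^k =
    +-mono-≤ (≤-reflexive (time-singletonsᵗ xs))
      -- For singletons, the number of lists and the number of elements both equal `length xs`,
      -- which serves as `m`.
      (time-mergeAllᵗ k (value (singletonsᵗ xs)) _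
        (subst (_≤ 2 ^ k) (sym (length-singletonsᵗ xs)) m≤2^k)
        (≤-reflexive (length-singletonsᵗ xs))
        (≤-reflexive (length-concat-singletonsᵗ xs)))

  length-sortᵗ : ∀ xs → length (value (sortᵗ xs)) ≡ length xs
  length-sortᵗ xs = trans (cong length (sortᵗ-value O xs)) (↭-length (sort-↭ O xs))

-- Constant-time array operations and relaxations

time-if : ∀ b {x y : Timed A} {k} → time x ≤ k → time y ≤ k → time (if b then x else y) ≤ k
time-if true  x≤k y≤k = x≤k
time-if false x≤k y≤k = y≤k

-- Bounding both branches of each test makes the constants here and below independent of the memory
-- contents.
time-written? : ∀ (a : Array n A) i → time (written? a i) ≤ 4
time-written? a i =
  +-monoʳ-≤ 2 (time-if (does (Array.back a i <? Array.top a)) ≤-refl (s≤s z≤n))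

time-readArray : ∀ (a : Array n A) i → time (readArray a i) ≤ 5
time-readArray a i = +-mono-≤ (time-written? a i) (time-if (value (written? a i)) ≤-refl ≤-refl)

-- The worst case is a first write: 4 for the test, 3 stores and 1 for the result.
time-writeArray : ∀ (a : Array n A) i x → time (writeArray a i x) ≤ 8
time-writeArray a i x =
  +-mono-≤ (time-written? a i) (+-monoʳ-≤ 1 (time-if (value (written? a i)) (s≤s z≤n) ≤-refl))

time-initialise : ∀ (mem : Memory n) s → time (initialise mem s) ≤ 20
time-initialise mem s =
  +-monoʳ-≤ 1 (+-mono-≤ (time-writeArray (value (newArray reachedBlock false)) s true)
    (+-monoʳ-≤ 2 (+-monoˡ-≤ 1 (time-writeArray (value (newArray arrivalBlock ⊤⁺)) s (fin 0)))))
  where open Memory mem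

-- Three reads, a comparison, three writes and the result: `3 * 5 + 1 + 3 * 8 + 1`.
time-relax : ∀ (st : State n) e → time (relax st e) ≤ 41
time-relax st (timeEdge a b l) =
  +-mono-≤ (time-readArray reached a) (+-mono-≤ (time-readArray reached b)
    (+-mono-≤ (time-readArray arrival a) (+-monoʳ-≤ 1
      (time-if (entry reached a ∧ not (entry reached b) ∧ does (entry arrival a <⁺? fin l))
        (+-mono-≤ (time-writeArray parent b (just a))
          (+-mono-≤ (time-writeArray arrival b (fin l))
            (+-monoˡ-≤ 1 (time-writeArray reached b true))))
        (s≤s z≤n)))))
  where open State st

time-relaxAll : ∀ (st : State n) es → time (relaxAll st es) ≤ length es * 41 + 1
time-relaxAll st []       = ≤-refl
time-relaxAll st (e ∷ es) = begin
  time (relax st e) + time (relaxAll (value (relax st e)) es)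
    ≤⟨ +-mono-≤ (time-relax st e) (time-relaxAll _ es) ⟩
  41 + (length es * 41 + 1)
    ≡⟨ +-assoc 41 (length es * 41) 1 ⟨
  suc (length es) * 41 + 1
    ∎

-- Total running time

time-foremostJourney : ∀ k (mem : Memory n) S s → length S ≤ 2 ^ k →
  time (foremostJourney mem S s) ≤ 23 + 42 * length S + k * (1 + 3 * length S)
time-foremostJourney {n} k mem S s m≤2^k = begin
  time (foremostJourney mem S s)
    ≤⟨ +-mono-≤ (time-sortᵗ (byLabel n) k S m≤2^k)
         (+-mono-≤ (time-initialise mem s) (time-relaxAll (value (initialise mem s)) S′)) ⟩
  m + 1 + (1 + k * (1 + 3 * m)) + (20 + (length S′ * 41 + 1))
    -- Sorting keeps the number of time edges, so exactly `m` relaxations are charged.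
    ≡⟨ cong (λ m′ → m + 1 + (1 + k * (1 + 3 * m)) + (20 + (m′ * 41 + 1)))
         (length-sortᵗ (byLabel n) S) ⟩
  m + 1 + (1 + k * (1 + 3 * m)) + (20 + (m * 41 + 1))
    ≡⟨ eq k m ⟩
  23 + 42 * m + k * (1 + 3 * m)
    ∎
  where
  m  = length S
  S′ = value (TimedMergeSort.sortᵗ (byLabel n) S)

  eq : ∀ k m → m + 1 + (1 + k * (1 + 3 * m)) + (20 + (m * 41 + 1))
                 ≡ 23 + 42 * m + k * (1 + 3 * m)
  eq = solve-∀

-- Constants become multiples of `c` by `1 ≤ c`, and then multiples of `c * l` by `1 ≤ l`. The
-- linear part is `23 + 84 + 14 = 121`, and the logarithmic term adds 7.
absorb-lower-order : ∀ {m c l} → m ≤ 2 * c → 1 ≤ c → 1 ≤ l →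
                     23 + 42 * m + (2 + l) * (1 + 3 * m) ≤ 128 * (c * l)
absorb-lower-order {m} {c} {l} m≤2c 1≤c 1≤l = begin
  23 + 42 * m + (2 + l) * (1 + 3 * m)
    ≤⟨ +-mono-≤ (+-mono-≤ (*-monoʳ-≤ 23 1≤c) (*-monoʳ-≤ 42 m≤2c))
         (*-monoʳ-≤ (2 + l) (+-mono-≤ 1≤c (*-monoʳ-≤ 3 m≤2c))) ⟩
  23 * c + 42 * (2 * c) + (2 + l) * (c + 3 * (2 * c))
    ≡⟨ collect c l ⟩
  121 * c + 7 * (c * l)
    ≤⟨ +-monoˡ-≤ (7 * (c * l)) (*-monoʳ-≤ 121 (m≤m*n c l)) ⟩
  121 * (c * l) + 7 * (c * l)
    ≡⟨ *-distribʳ-+ (c * l) 121 7 ⟨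
  128 * (c * l)
    ∎
  where
  instance
    l≢0 : NonZero l
    l≢0 = >-nonZero 1≤l

  collect : ∀ c l → 23 * c + 42 * (2 * c) + (2 + l) * (c + 3 * (2 * c)) ≡ 121 * c + 7 * (c * l)
  collect = solve-∀

corollary1 : ∃[ C ] ∃[ N ]
    (∀ {κ : Kind} (G : TemporalGraph κ) (s : Vertex G)
    (S : List (TimeEdge (order G))) → S ↭ timeEdges G →
    (mem : Memory (order G)) →
    N ≤ cost G →
    time (foremostJourney mem S s) ≤ C * (cost G * ⌊log₂ cost G ⌋))
-- From cost 2 on, the logarithm is at least 1; at cost 1 the right-hand side would vanish.
corollary1 = 128 , 2 , λ G s S S↭ mem 2≤c →
  let m≤2c = ≤-trans (≤-reflexive (↭-length S↭)) (length-timeEdges G)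
      -- Of the 2 in the exponent, one pays for the factor 2 in `m≤2c`, the other for rounding the
      -- logarithm down.
      2c≤2^[2+l] = *-monoʳ-≤ 2 (<⇒≤ (n<2^[1+⌊log₂n⌋] (cost G)))
  in ≤-trans
       (time-foremostJourney (2 + ⌊log₂ cost G ⌋) mem S s (≤-trans m≤2c 2c≤2^[2+l]))
       (absorb-lower-order m≤2c (<⇒≤ 2≤c) (⌊log₂⌋-mono-≤ 2≤c))
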